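{- Let $n \geq 4$ and $k \geq 2$ be integers with $2^k - 1 < n < 2^{k+1} - 1$. Then there exists a total perfect dominating set $D$ of the hypercube $Q_n$ with $|D| = 2^{n-k}$ such that $Q_n - D$ is $(n-1)$-regular, $(n-1)$-connected and bipancyclic.
   Context: The hypercube $Q_n$ has vertex set $\{0,1\}^n$, two vertices being adjacent iff they differ in exactly one coordinate. For $D \subseteq V(Q_n)$, $Q_n - D$ is the subgraph induced on $V(Q_n)\setminus D$. A perfect dominating set of a graph is a set $D$ of vertices such that every vertex not in $D$ is adjacent to exactly one vertex of $D$; it is total if moreover every vertex of $D$ is adjacent to at least one vertex of $D$. A graph $G$ is bipancyclic if for every even integer $l$ with $4 \leq l \leq |V(G)|$, $G$ contains a cycle of length $l$. -}

module Defs where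

open import Level using (0ℓ)
open import Data.Bool.Base using (Bool; T; not)
open import Data.List.Base using (List; length; _∷_; _∷ʳ_)
open import Data.List.Membership.Propositional using () renaming (_∈_ to _∈ᴸ_)
open import Data.List.Relation.Unary.Linked using (Linked)
open import Data.List.Relation.Unary.Unique.Propositional using (Unique)
open import Data.Nat.Base using (ℕ; _≤_; _<_)
open import Data.Nat.Divisibility using (_∣_)
open import Data.Product.Base using (Σ-syntax; ∃-syntax; _×_; _,_; proj₁)
open import Data.Product using (∃!)
open import Data.Vec.Base using (Vec; lookup)
open import Function.Base using (_∘_; _on_)
open import Function.Bundles using (_⇔_)
open import Relation.Binary.Construct.Closure.ReflexiveTransitive using (Star)
open import Relation.Binary.Core using (Rel)
open import Relation.Binary.Definitions using (Symmetric)
open import Relation.Binary.PropositionalEquality using (_≡_; _≢_; refl; sym)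
open import Relation.Nullary using (¬_)
open import Relation.Unary using (Pred; U)

-- "Exactly m elements satisfy P", witnessed by a repetition-free list of them.
-- P need not be proof-irrelevant: elements are counted, not proofs.
_HasSize_ : {A : Set} → Pred A 0ℓ → ℕ → Set
_HasSize_ {A} P m =
  Σ[ xs ∈ List A ] Unique xs × (∀ x → (x ∈ᴸ xs) ⇔ P x) × length xs ≡ m

record Graph : Set₁ where
  field
    Vertex   : Set
    _~_      : Rel Vertex 0ℓ
    ~-sym    : Symmetric _~_
    ~-irrefl : ∀ {v} → ¬ (v ~ v)

open Graph using (Vertex)

-- Subsets are Boolean-valued so that membership is proof-irrelevant; hence
-- vertices of an induced subgraph are equal iff they are equal in G.
VertexSet : Graph → Set
VertexSet G = Vertex G → Bool

_∈_ _∉_ : {A : Set} → A → (A → Bool) → Set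
v ∈ S = T (S v)
v ∉ S = T (not (S v))

infix 4 _∈_ _∉_
infixl 6 _−_

_−_ : (G : Graph) → VertexSet G → Graph
G − S = record
  { Vertex   = Σ[ v ∈ Vertex G ] v ∉ S
  ; _~_      = _~_ on proj₁
  ; ~-sym    = ~-sym
  ; ~-irrefl = ~-irrefl
  }
  where open Graph G using (_~_; ~-sym; ~-irrefl)

Q : ℕ → Graph
Q n = record
  { Vertex   = Vec Bool n
  ; _~_      = λ u v → ∃! _≡_ (λ i → lookup u i ≢ lookup v i)
  ; ~-sym    = λ (i , i≢ , uniq) → i , i≢ ∘ sym , λ j≢ → uniq (j≢ ∘ sym)
  ; ~-irrefl = λ (_ , i≢ , _) → i≢ refl
  }

module _ (G : Graph) where
  open Graph G using (_~_)

  PerfectDominating : VertexSet G → Set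
  PerfectDominating D = ∀ v → v ∉ D → ∃! _≡_ (λ u → u ∈ D × v ~ u)

  TotalPerfectDominating : VertexSet G → Set
  TotalPerfectDominating D =
    PerfectDominating D × (∀ v → v ∈ D → ∃[ u ] (u ∈ D × v ~ u))

  Regular : ℕ → Set
  Regular d = ∀ v → (v ~_) HasSize d

  Connected : Set
  Connected = ∀ u v → Star _~_ u v

  -- A cycle is given by its vertices v, w₁, …, wₗ₋₁ in cyclic order.
  HasCycle : ℕ → Set
  HasCycle l = 3 ≤ l × ∃[ v ] ∃[ ws ]
    (length (v ∷ ws) ≡ l × Unique (v ∷ ws) × Linked _~_ (v ∷ ws ∷ʳ v))

  Bipancyclic : Set
  Bipancyclic = ∃[ N ] (U {A = Vertex G} HasSize N ×
    (∀ l → 2 ∣ l → 4 ≤ l → l ≤ N → HasCycle l))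

-- More than κ vertices, and connected after deleting any fewer than κ of them.
-- `Connected` admits the empty graph, but the first condition ensures that
-- the graphs G − S below are nonempty.
_-Connected_ : ℕ → Graph → Set
κ -Connected G =
  (∃[ N ] (U {A = Vertex G} HasSize N × κ < N)) ×
  (∀ (S : VertexSet G) s → (_∈ S) HasSize s → s < κ → Connected (G − S))

{-# OPTIONS --safe #-}
module Submission where

-- Let D be the product of a Hamming code in Q_r, r = 2ᵏ − 1, with Q_(n−r), where n − r ≥ 1. The neighbours of
-- a vertex of Q_r realise every syndrome but its own exactly once, so the code is perfect; total domination
-- comes from the other factor.
-- Cycles: if Q_r minus a code coset has a Hamiltonian path, then so has the product with Q_(n−r−1), and the
-- ladder over this path, its product with an edge, has cycles of all even lengths. The Hamiltonian path is
-- built by recursion on k: Q_(2r+1) is fibred over Q_r × Q_1, and along each edge of Q_1 one fibre is Q_r minus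
-- a coset and the other one is all of Q_r, where any two vertices of opposite parity can be linked.
-- Connectivity: by induction on n, splitting Q_n along a coordinate, any code with distinct words at distance
-- at least 3 leaves an (n−1)-connected graph; then each factor Q_1 raises the connectivity by one.

open import Data.Bool.Base using (Bool; true; false; not; T; _xor_)
open import Data.Bool.Properties as Bool using (not-¬; ¬-not; T-irrelevant)
open import Data.Fin.Base using (zero; suc)
import Data.Fin.Properties as Fin
open import Data.List.Base using (List; []; _∷_; _++_; _∷ʳ_; length; map; reverse; take; filter)
open import Data.List.Membership.Propositional using (find; lose) renaming (_∈_ to _∈ᴸ_; _∉_ to _∉ᴸ_)
open import Data.List.Membership.Propositional.Properties
  using (∈-map⁺; ∈-map⁻; ∈-++⁺ˡ; ∈-++⁺ʳ; ∈-++⁻; ∈-length; ∈-filter⁺; ∈-filter⁻)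
open import Data.List.Properties
  using (length-++; length-map; map-++; length-reverse; length-take; filter-notAll; unfold-reverse)
open import Data.List.Relation.Unary.All as All using (All; []; _∷_)
import Data.List.Relation.Unary.All.Properties as All
open import Data.List.Relation.Unary.AllPairs using ([]; _∷_)
open import Data.List.Relation.Unary.Any as Any using (Any; here; there)
open import Data.List.Relation.Unary.Any.Properties using (reverse⁺; reverse⁻)
open import Data.List.Relation.Unary.Linked using (Linked; [-]; _∷_)
import Data.List.Relation.Unary.Linked as Linked
import Data.List.Relation.Unary.Linked.Properties as Linked
open import Data.List.Relation.Unary.Unique.Propositional using (Unique)
import Data.List.Relation.Unary.Unique.Propositional.Properties as Unique
open import Data.List.Relation.Unary.Unique.DecPropositional using (unique?)
open import Data.Nat using (ℕ; zero; suc; _+_; _*_; _∸_; _^_; _≤_; _<_; z≤n; s≤s; s<s⁻¹; s≤s⁻¹)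
open import Data.Nat.Divisibility using (_∣_; divides)
import Data.Nat.Properties as ℕ
open import Data.Product using (Σ-syntax; ∃-syntax; _×_; _,_; proj₁; proj₂)
open import Data.Sum using (_⊎_; inj₁; inj₂)
open import Data.Unit using (tt)
open import Data.Vec.Base as Vec using (Vec; []; _∷_; lookup; zipWith) renaming (_++_ to _++ⱽ_)
import Data.Vec.Properties as Vec
open import Function.Base using (_∘_; case_of_)
open import Function.Bundles using (_⇔_; mk⇔; Equivalence)
open import Level using (0ℓ)
open import Relation.Binary.Construct.Closure.ReflexiveTransitive as Star using (Star; ε; _◅_; _◅◅_)
open import Relation.Binary.Core using (Rel)
open import Relation.Binary.Definitions using (Symmetric; DecidableEquality)
open import Relation.Binary.PropositionalEquality
open import Relation.Nullary using (¬_; Dec; yes; no; contradiction)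
open import Relation.Nullary.Decidable
  using (isYes; map′; _×-dec_; _→-dec_; decidable-stable; ¬?;
         toWitness; fromWitness; toWitnessFalse; fromWitnessFalse)
open import Relation.Unary using (Pred; Decidable; U)
open import Defs

open Equivalence using (to; from)

-- Enumerations and paths

_Enumerates_ : {A : Set} → List A → Pred A 0ℓ → Set
xs Enumerates P = Unique xs × (∀ x → (x ∈ᴸ xs) ⇔ P x)

enumerates-resp : {A : Set} {xs : List A} {P P′ : Pred A 0ℓ} →
  (∀ x → P x ⇔ P′ x) → xs Enumerates P → xs Enumerates P′
enumerates-resp P⇔ (xs! , xs⇔) =
  xs! , λ x → mk⇔ (to (P⇔ x) ∘ to (xs⇔ x)) (from (xs⇔ x) ∘ from (P⇔ x))

enumerates-[_] : {A : Set} (x : A) → (x ∷ []) Enumerates (_≡ x)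
enumerates-[ x ] = ([] ∷ []) , λ y → mk⇔ (λ { (here eq) → eq ; (there ()) }) here

enumerates-++ : {A : Set} {xs ys : List A} {P P′ : Pred A 0ℓ} →
  xs Enumerates P → ys Enumerates P′ → (∀ x → P x → ¬ P′ x) →
  (xs ++ ys) Enumerates (λ x → P x ⊎ P′ x)
enumerates-++ {xs = xs} {ys} (xs! , xs⇔) (ys! , ys⇔) disjoint =
  Unique.++⁺ xs! ys! (λ (x∈xs , x∈ys) → disjoint _ (to (xs⇔ _) x∈xs) (to (ys⇔ _) x∈ys)) ,
  λ x → mk⇔
    (λ x∈ → case ∈-++⁻ xs x∈ of λ where
      (inj₁ x∈xs) → inj₁ (to (xs⇔ x) x∈xs)
      (inj₂ x∈ys) → inj₂ (to (ys⇔ x) x∈ys))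
    (λ where
      (inj₁ p) → ∈-++⁺ˡ (from (xs⇔ x) p)
      (inj₂ p) → ∈-++⁺ʳ xs (from (ys⇔ x) p))

enumerates-map : {A B : Set} {f : A → B} → (∀ {x y} → f x ≡ f y → x ≡ y) →
  {xs : List A} {P : Pred A 0ℓ} → xs Enumerates P →
  map f xs Enumerates (λ y → ∃[ x ] (P x × y ≡ f x))
enumerates-map {f = f} f-inj (xs! , xs⇔) =
  Unique.map⁺ f-inj xs! ,
  λ y → mk⇔
    (λ y∈ → let x , x∈ , eq = ∈-map⁻ f y∈ in x , to (xs⇔ x) x∈ , eq)
    (λ { (x , p , refl) → ∈-map⁺ f (from (xs⇔ x) p) })

unique-reverse : {A : Set} {xs : List A} → Unique xs → Unique (reverse xs)
unique-reverse [] = []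
unique-reverse {xs = x ∷ xs} (x# ∷ xs!) rewrite unfold-reverse x xs =
  Unique.++⁺ (unique-reverse xs!) ([] ∷ [])
    λ { (x∈ , here refl) → All.lookup x# (reverse⁻ x∈) refl }

enumerates-reverse : {A : Set} {xs : List A} {P : Pred A 0ℓ} →
  xs Enumerates P → reverse xs Enumerates P
enumerates-reverse (xs! , xs⇔) =
  unique-reverse xs! , λ x → mk⇔ (to (xs⇔ x) ∘ reverse⁻) (reverse⁺ ∘ from (xs⇔ x))

enumerates-remove : {A : Set} {xs : List A} {P : Pred A 0ℓ} → xs Enumerates P →
  ∀ {x} → P x → Σ[ ys ∈ List A ] ys Enumerates (λ y → P y × y ≢ x) × length xs ≡ suc (length ys)
enumerates-remove {A} (xs! , xs⇔) {x} p =
  let ys , (ys! , ys⇔) , eq = go xs! (from (xs⇔ x) p)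
  in ys , enumerates-resp
       (λ y → mk⇔ (λ (y∈ , y≢) → to (xs⇔ y) y∈ , y≢) (λ (py , y≢) → from (xs⇔ y) py , y≢))
       (ys! , ys⇔) , eq
  where
  go : ∀ {xs} → Unique xs → x ∈ᴸ xs →
    Σ[ ys ∈ List A ] ys Enumerates (λ y → y ∈ᴸ xs × y ≢ x) × length xs ≡ suc (length ys)
  go {_ ∷ xs} (x# ∷ xs!) (here refl) =
    xs , (xs! , λ y → mk⇔ (λ y∈ → there y∈ , λ { refl → All.lookup x# y∈ refl })
                          (λ { (here eq , y≢) → contradiction eq y≢ ; (there y∈ , _) → y∈ })) , refl
  go {z ∷ xs} (z# ∷ xs!) (there x∈) with go xs! x∈
  ... | ys , (ys! , ys⇔) , eq =
    z ∷ ys , (All.tabulate (λ y∈ → All.lookup z# (proj₁ (to (ys⇔ _) y∈))) ∷ ys! , λ y → mk⇔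
      (λ { (here refl) → here refl , All.lookup z# x∈
         ; (there y∈) → let y∈xs , y≢ = to (ys⇔ y) y∈ in there y∈xs , y≢ })
      (λ { (here eq , _) → here eq
         ; (there y∈ , y≢) → there (from (ys⇔ y) (y∈ , y≢)) })) , cong suc eq

-- A head of `xs` that occurs in `L` is filtered out of `L`, which shortens `L`; the witness then
-- found in the tail differs from that head by uniqueness. `L` itself may repeat entries.
pigeonhole : {A : Set} → DecidableEquality A → {xs : List A} → Unique xs → (L : List A) →
  length L < length xs → ∃[ x ] (x ∈ᴸ xs × x ∉ᴸ L)
pigeonhole _≟_ {[]} [] L ()
pigeonhole _≟_ {x ∷ xs} (x# ∷ xs!) L L<xs with Any.any? (x ≟_) L
... | no x∉L = x , here refl , x∉L
... | yes x∈L =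
  let y , y∈xs , y∉ = pigeonhole _≟_ xs! (filter x≢? L)
                        (s<s⁻¹ (ℕ.<-≤-trans (s≤s (filter-notAll x≢? L (Any.map contradiction x∈L))) L<xs))
  in y , there y∈xs , λ y∈L → y∉ (∈-filter⁺ x≢? y∈L (All.lookup x# y∈xs))
  where x≢? = λ z → ¬? (x ≟ z)

data Path {A : Set} (R : Rel A 0ℓ) : A → A → List A → Set where
  [_] : ∀ x → Path R x x (x ∷ [])
  _∷_ : ∀ {x y z xs} → R x y → Path R y z xs → Path R x z (x ∷ xs)

module _ {A : Set} {R : Rel A 0ℓ} where

  path-++ : ∀ {u v w z xs ys} → Path R u v xs → R v w → Path R w z ys → Path R u z (xs ++ ys)
  path-++ [ _ ] r q = r ∷ q
  path-++ (r′ ∷ p) r q = r′ ∷ path-++ p r q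

  path-reverse : Symmetric R → ∀ {u v xs} → Path R u v xs → Path R v u (reverse xs)
  path-reverse R-sym [ x ] = [ x ]
  path-reverse R-sym {xs = x ∷ xs} (r ∷ p) rewrite unfold-reverse x xs =
    path-++ (path-reverse R-sym p) (R-sym r) [ x ]

  path-take : ∀ {u v xs} → Path R u v xs → ∀ j → ∃[ w ] Path R u w (take (suc j) xs)
  path-take [ x ] zero = x , [ x ]
  path-take [ x ] (suc j) = x , [ x ]
  path-take (_∷_ {x} r p) zero = x , [ x ]
  path-take (r ∷ p) (suc j) = let w , p′ = path-take p j in w , (r ∷ p′)

  path-linked : ∀ {u v w xs} → Path R u v xs → R v w → Linked R (xs ∷ʳ w)
  path-linked [ x ] r = r ∷ [-]
  path-linked (r′ ∷ [ x ]) r = r′ ∷ path-linked [ x ] r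
  path-linked (r′ ∷ p@(_ ∷ _)) r = r′ ∷ path-linked p r

path-map : {A B : Set} {R : Rel A 0ℓ} {R′ : Rel B 0ℓ} {f : A → B} →
  (∀ {x y} → R x y → R′ (f x) (f y)) →
  ∀ {u v xs} → Path R u v xs → Path R′ (f u) (f v) (map f xs)
path-map f-mono [ x ] = [ _ ]
path-map f-mono (r ∷ p) = f-mono r ∷ path-map f-mono p

-- A Hamiltonian path from u to v of the subgraph of (A , R) induced on P.
Traversal : {A : Set} → Rel A 0ℓ → Pred A 0ℓ → A → A → Set
Traversal R P u v = ∃[ xs ] (Path R u v xs × xs Enumerates P)

module _ {A : Set} {R : Rel A 0ℓ} where

  traversal-resp : {P P′ : Pred A 0ℓ} → (∀ x → P x ⇔ P′ x) →
    ∀ {u v} → Traversal R P u v → Traversal R P′ u v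
  traversal-resp P⇔ (xs , p , e) = xs , p , enumerates-resp P⇔ e

  traversal-[_] : ∀ x → Traversal R (_≡ x) x x
  traversal-[ x ] = x ∷ [] , [ x ] , enumerates-[ x ]

  traversal-++ : ∀ {P P′ : Pred A 0ℓ} {u v w z} →
    Traversal R P u v → R v w → Traversal R P′ w z → (∀ x → P x → ¬ P′ x) →
    Traversal R (λ x → P x ⊎ P′ x) u z
  traversal-++ (xs , p , e) r (ys , q , f) disjoint =
    xs ++ ys , path-++ p r q , enumerates-++ e f disjoint

  traversal-reverse : Symmetric R → ∀ {P : Pred A 0ℓ} {u v} → Traversal R P u v → Traversal R P v u
  traversal-reverse R-sym (xs , p , e) = reverse xs , path-reverse R-sym p , enumerates-reverse e

  traversal-tail : ∀ {P : Pred A 0ℓ} {u v} → Traversal R P u v → u ≢ v →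
    ∃[ w ] (R u w × Traversal R (λ x → P x × x ≢ u) w v)
  traversal-tail (_ , [ _ ] , _) u≢v = contradiction refl u≢v
  traversal-tail (_ ∷ xs , r ∷ p , (u# ∷ xs!) , xs⇔) _ = _ , r , xs , p , xs! , λ y → mk⇔
    (λ y∈ → to (xs⇔ y) (there y∈) , λ { refl → All.lookup u# y∈ refl })
    (λ (py , y≢) → case from (xs⇔ y) py of λ { (here eq) → contradiction eq y≢ ; (there y∈) → y∈ })

traversal-map : {A B : Set} {R : Rel A 0ℓ} {R′ : Rel B 0ℓ} {f : A → B} →
  (∀ {x y} → f x ≡ f y → x ≡ y) → (∀ {x y} → R x y → R′ (f x) (f y)) →
  ∀ {P u v} → Traversal R P u v → Traversal R′ (λ y → ∃[ x ] (P x × y ≡ f x)) (f u) (f v)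
traversal-map f-inj f-mono (xs , p , e) = map _ xs , path-map f-mono p , enumerates-map f-inj e
-- The hypercube

V : ℕ → Set
V = Vec Bool

_≟ⱽ_ : ∀ {n} → DecidableEquality (V n)
_≟ⱽ_ = Vec.≡-dec Bool._≟_

infix 4 _∼_

-- Adjacency by recursion on the position of the differing coordinate, which allows pattern
-- matching; `∼⇒~` and `~⇒∼` identify it with the adjacency of `Q n`.
data _∼_ : ∀ {n} → V n → V n → Set where
  flip : ∀ {n b c} {v : V n} → b ≢ c → b ∷ v ∼ c ∷ v
  keep : ∀ {n} b {u v : V n} → u ∼ v → b ∷ u ∼ b ∷ v

∼-sym : ∀ {n} → Symmetric (_∼_ {n})
∼-sym (flip b≢c) = flip (≢-sym b≢c)
∼-sym (keep b u∼v) = keep b (∼-sym u∼v)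

∼-irrefl : ∀ {n} {v : V n} → ¬ v ∼ v
∼-irrefl (flip b≢b) = b≢b refl
∼-irrefl (keep _ v∼v) = ∼-irrefl v∼v

∼⇒~ : ∀ {n} {u v : V n} → u ∼ v → Graph._~_ (Q n) u v
∼⇒~ (flip b≢c) = zero , b≢c ,
  λ { {zero} _ → refl ; {suc _} differ → contradiction refl differ }
∼⇒~ (keep b u∼v) =
  let i , i≢ , unique = ∼⇒~ u∼v in suc i , i≢ ,
  λ { {zero} differ → contradiction refl differ ; {suc _} differ → cong suc (unique differ) }

lookup-injective : ∀ {n} (u v : V n) → (∀ i → lookup u i ≡ lookup v i) → u ≡ v
lookup-injective [] [] _ = refl
lookup-injective (b ∷ u) (c ∷ v) agree = cong₂ _∷_ (agree zero) (lookup-injective u v (agree ∘ suc))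

~⇒∼ : ∀ {n} {u v : V n} → Graph._~_ (Q n) u v → u ∼ v
~⇒∼ {u = b ∷ u} {c ∷ v} (zero , b≢c , unique) =
  subst (λ w → b ∷ u ∼ c ∷ w) (lookup-injective u v λ j →
    decidable-stable (lookup u j Bool.≟ lookup v j) λ differ → case unique {suc j} differ of λ ()) (flip b≢c)
~⇒∼ {u = b ∷ u} {c ∷ v} (suc i , i≢ , unique) with b Bool.≟ c
... | no b≢c = case unique {zero} b≢c of λ ()
... | yes refl = keep b (~⇒∼ (i , i≢ , λ differ → Fin.suc-injective (unique {suc _} differ)))

neighbours : ∀ {n} → V n → List (V n)
neighbours [] = []
neighbours (b ∷ v) = (not b ∷ v) ∷ map (b ∷_) (neighbours v)

neighbours-enumerates : ∀ {n} (v : V n) → neighbours v Enumerates (v ∼_)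
neighbours-enumerates [] = [] , λ { [] → mk⇔ (λ ()) (λ ()) }
neighbours-enumerates (b ∷ v) = enumerates-resp
  (λ u → mk⇔ (λ { (inj₁ refl) → flip (not-¬ refl) ; (inj₂ (x , v∼x , refl)) → keep b v∼x })
             (λ { (flip b≢c) → inj₁ (cong (_∷ v) (¬-not (≢-sym b≢c)))
                ; (keep _ v∼x) → inj₂ (_ , v∼x , refl) }))
  (enumerates-++ enumerates-[ not b ∷ v ]
    (enumerates-map Vec.∷-injectiveʳ (neighbours-enumerates v))
    λ { _ refl (_ , _ , eq) → not-¬ refl (sym (Vec.∷-injectiveˡ eq)) })

length-neighbours : ∀ {n} (v : V n) → length (neighbours v) ≡ n
length-neighbours [] = refl
length-neighbours (b ∷ v) = cong suc (trans (length-map (b ∷_) (neighbours v)) (length-neighbours v))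

parity : ∀ {n} → V n → Bool
parity [] = false
parity (b ∷ v) = b xor parity v

parity-∼ : ∀ {n} {u v : V n} → u ∼ v → parity v ≡ not (parity u)
parity-∼ {u = b ∷ v} (flip b≢c) rewrite ¬-not (≢-sym b≢c) = sym (Bool.not-distribˡ-xor b (parity v))
parity-∼ (keep b {u} u∼v) rewrite parity-∼ u∼v = sym (Bool.not-distribʳ-xor b (parity u))

parity-++ : ∀ {m n} (u : V m) (v : V n) → parity (u ++ⱽ v) ≡ parity u xor parity v
parity-++ [] v = refl
parity-++ (b ∷ u) v rewrite parity-++ u v = sym (Bool.xor-assoc b (parity u) (parity v))

HamPath : ∀ {n} → Pred (V n) 0ℓ → V n → V n → Set
HamPath = Traversal _∼_

hamPath-∷ : ∀ {n} b {P : Pred (V n) 0ℓ} {u v} → HamPath P u v →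
  HamPath (λ w → ∃[ x ] (P x × w ≡ b ∷ x)) (b ∷ u) (b ∷ v)
hamPath-∷ b = traversal-map Vec.∷-injectiveʳ (keep b)

-- One copy is run through forwards and the other one backwards, so a path doubles to a path whose
-- ends differ in the first bit only and hence are adjacent.
double : ∀ {n} → List (V n) → List (V (suc n))
double xs = map (false ∷_) xs ++ map (true ∷_) (reverse xs)

double-path : ∀ {n} {u v : V n} {xs} → Path _∼_ u v xs → Path _∼_ (false ∷ u) (true ∷ u) (double xs)
double-path p = path-++ (path-map (keep false) p) (flip λ ()) (path-map (keep true) (path-reverse ∼-sym p))

double-enumerates : ∀ {n} {xs} {P : Pred (V n) 0ℓ} → xs Enumerates P → double xs Enumerates (P ∘ Vec.tail)
double-enumerates e = enumerates-resp
  (λ where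
    (false ∷ v) → mk⇔ (λ { (inj₁ (_ , p , refl)) → p ; (inj₂ (_ , _ , ())) }) (λ p → inj₁ (v , p , refl))
    (true ∷ v) → mk⇔ (λ { (inj₁ (_ , _ , ())) ; (inj₂ (_ , p , refl)) → p }) (λ p → inj₂ (v , p , refl)))
  (enumerates-++ (enumerates-map Vec.∷-injectiveʳ e) (enumerates-map Vec.∷-injectiveʳ (enumerates-reverse e))
    λ { _ (_ , _ , refl) (_ , _ , ()) })

length-double : ∀ {n} (xs : List (V n)) → length (double xs) ≡ length xs * 2
length-double xs = begin
  length (double xs)                                                        ≡⟨ length-++ (map (false ∷_) xs) ⟩
  length (map (false ∷_) xs) + length (map (true ∷_) (reverse xs))
    ≡⟨ cong₂ _+_ (length-map (false ∷_) xs) (trans (length-map (true ∷_) (reverse xs)) (length-reverse xs)) ⟩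
  length xs + length xs                                                     ≡⟨ cong (length xs +_) (ℕ.+-identityʳ (length xs)) ⟨
  2 * length xs                                                             ≡⟨ ℕ.*-comm 2 (length xs) ⟩
  length xs * 2                                                             ∎
  where open ≡-Reasoning

hamPath-tail : ∀ {n} {P : Pred (V n) 0ℓ} {u v} → HamPath P u v → HamPath (P ∘ Vec.tail) (false ∷ u) (true ∷ u)
hamPath-tail (xs , p , e) = double xs , double-path p , double-enumerates e

-- Havel: if u and v start with the same bit, then the first edge u x of a path through their half is
-- replaced with a path from u to x through the other half.
hamPath-lace : ∀ {n} (u v : V n) → parity u ≢ parity v → HamPath U u v
hamPath-lace [] [] odd = contradiction refl odd
hamPath-lace (b ∷ u) (c ∷ v) odd with b Bool.≟ c
hamPath-lace (b ∷ []) (c ∷ []) odd | no b≢c = traversal-resp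
  (λ { (a ∷ []) → mk⇔ (λ _ → tt) (λ _ → case a Bool.≟ b of λ where
    (yes refl) → inj₁ refl
    (no a≢b) → inj₂ (cong (_∷ []) (trans (¬-not a≢b) (sym (¬-not (≢-sym b≢c)))))) })
  (traversal-++ traversal-[ b ∷ [] ] (flip b≢c) traversal-[ c ∷ [] ] λ { _ refl refl → b≢c refl })
hamPath-lace (b ∷ u@(a ∷ u′)) (c ∷ v) odd | no b≢c = traversal-resp
  (λ { (d ∷ x) → mk⇔ (λ _ → tt) (λ _ → case d Bool.≟ b of λ where
    (yes refl) → inj₁ (x , tt , refl)
    (no d≢b) → inj₂ (x , tt , cong (_∷ x) (trans (¬-not d≢b) (sym (¬-not (≢-sym b≢c)))))) })
  (traversal-++ (hamPath-∷ b (hamPath-lace u w u≁w)) (flip b≢c) (hamPath-∷ c (hamPath-lace w v w≁v))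
    λ { _ (_ , _ , refl) (_ , _ , eq) → b≢c (Vec.∷-injectiveˡ eq) })
  where
  -- The crossing point: since `b ≢ c`, the tails `u` and `v` have equal parity, and `w`, a
  -- neighbour of `u`, has the opposite one.
  w = not a ∷ u′
  flipped : parity u ≡ not (parity w)
  flipped = parity-∼ (flip {v = u′} (≢-sym (not-¬ {a} refl)))
  u≁w : parity u ≢ parity w
  u≁w eq = not-¬ eq flipped
  w≁v : parity w ≢ parity v
  w≁v eq = odd (begin
    b xor parity u        ≡⟨ cong (b xor_) (trans flipped (cong not eq)) ⟩
    b xor not (parity v)  ≡⟨ Bool.not-distribʳ-xor b (parity v) ⟨
    not (b xor parity v)  ≡⟨ Bool.not-distribˡ-xor b (parity v) ⟩
    not b xor parity v    ≡⟨ cong (_xor parity v) (¬-not (≢-sym b≢c)) ⟨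
    c xor parity v        ∎)
    where open ≡-Reasoning
hamPath-lace (b ∷ u) (b ∷ v) odd | yes refl with hamPath-lace u v (odd ∘ cong (b xor_))
... | h with traversal-tail h (odd ∘ cong (parity ∘ (b ∷_)))
... | x , u∼x , rest = traversal-resp
  (λ { (d ∷ y) → mk⇔ (λ _ → tt) (λ _ → case d Bool.≟ b of λ where
    (no d≢b) → inj₂ (inj₁ (y , tt , cong (_∷ y) (¬-not d≢b)))
    (yes refl) → case y ≟ⱽ u of λ where
      (yes refl) → inj₁ refl
      (no y≢u) → inj₂ (inj₂ (y , (tt , y≢u) , refl))) })
  (traversal-++ traversal-[ b ∷ u ] (flip (not-¬ refl))
    (traversal-++ (hamPath-∷ (not b) (hamPath-lace u x (λ eq → not-¬ (sym eq) (parity-∼ u∼x))))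
      (flip (≢-sym (not-¬ refl))) (hamPath-∷ b rest)
      λ { _ (_ , _ , refl) (_ , _ , eq) → not-¬ refl (sym (Vec.∷-injectiveˡ eq)) })
    λ { _ refl (inj₁ (_ , _ , eq)) → not-¬ refl (Vec.∷-injectiveˡ eq)
      ; _ refl (inj₂ (_ , (_ , u≢u) , refl)) → u≢u refl })
-- The Hamming syndrome

infixl 6 _⊕_

_⊕_ : ∀ {n} → V n → V n → V n
_⊕_ = zipWith _xor_

⊕-comm : ∀ {n} (u v : V n) → u ⊕ v ≡ v ⊕ u
⊕-comm = Vec.zipWith-comm Bool.xor-comm

xor-cancelʳ : ∀ b c → (b xor c) xor c ≡ b
xor-cancelʳ false c = Bool.xor-same c
xor-cancelʳ true false = refl
xor-cancelʳ true true = refl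

⊕-cancelʳ : ∀ {n} (u v : V n) → u ⊕ v ⊕ v ≡ u
⊕-cancelʳ [] [] = refl
⊕-cancelʳ (b ∷ u) (c ∷ v) = cong₂ _∷_ (xor-cancelʳ b c) (⊕-cancelʳ u v)

⊕-injectiveˡ : ∀ {n} {u u′ : V n} v → u ⊕ v ≡ u′ ⊕ v → u ≡ u′
⊕-injectiveˡ {u = u} {u′} v eq = trans (sym (⊕-cancelʳ u v)) (trans (cong (_⊕ v) eq) (⊕-cancelʳ u′ v))

⊕-injectiveʳ : ∀ {n} u {v v′ : V n} → u ⊕ v ≡ u ⊕ v′ → v ≡ v′
⊕-injectiveʳ u {v} {v′} eq = ⊕-injectiveˡ u (trans (⊕-comm v u) (trans eq (⊕-comm u v′)))

⊕-solveˡ : ∀ {n} {t u : V n} v → u ≡ t ⊕ v → u ⊕ v ≡ t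
⊕-solveˡ {t = t} v eq = trans (cong (_⊕ v) eq) (⊕-cancelʳ t v)

++-∼ˡ : ∀ {m n} {x x′ : V m} (y : V n) → x ∼ x′ → x ++ⱽ y ∼ x′ ++ⱽ y
++-∼ˡ y (flip b≢c) = flip b≢c
++-∼ˡ y (keep b x∼x′) = keep b (++-∼ˡ y x∼x′)

++-∼ʳ : ∀ {m n} (x : V m) {y y′ : V n} → y ∼ y′ → x ++ⱽ y ∼ x ++ⱽ y′
++-∼ʳ [] y∼y′ = y∼y′
++-∼ʳ (b ∷ x) y∼y′ = keep b (++-∼ʳ x y∼y′)

++-∼⁻ : ∀ {m n} (x : V m) {y : V n} {u} → x ++ⱽ y ∼ u →
  (∃[ x′ ] (x ∼ x′ × u ≡ x′ ++ⱽ y)) ⊎ (∃[ y′ ] (y ∼ y′ × u ≡ x ++ⱽ y′))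
++-∼⁻ [] y∼u = inj₂ (_ , y∼u , refl)
++-∼⁻ (b ∷ x) (flip b≢c) = inj₁ (_ , flip b≢c , refl)
++-∼⁻ (b ∷ x) (keep .b xy∼u) with ++-∼⁻ x xy∼u
... | inj₁ (x′ , x∼x′ , refl) = inj₁ (b ∷ x′ , keep b x∼x′ , refl)
... | inj₂ (y′ , y∼y′ , refl) = inj₂ (y′ , y∼y′ , refl)

-- This is 2ᵏ - 1, in a form that presents the cube for k + 1 as Q_1 times two copies of the cube
-- for k; `join` gives these coordinates.
dim : ℕ → ℕ
dim zero = 0
dim (suc k) = suc (dim k + dim k)

join : ∀ {n} → Bool → V n → V n → V (suc (n + n))
join b x y = b ∷ x ++ⱽ y

data Split {n} : V (suc (n + n)) → Set where
  split : ∀ b (x y : V n) → Split (join b x y)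

splitting : ∀ n v → Split {n} v
splitting n (b ∷ v) = subst (λ w → Split {n} (b ∷ w)) (Vec.take++drop≡id n v) (split {n} b (Vec.take n v) (Vec.drop n v))

join-injective : ∀ {n b b′} {x x′ y y′ : V n} → join b x y ≡ join b′ x′ y′ → b ≡ b′ × x ≡ x′ × y ≡ y′
join-injective eq = Vec.∷-injectiveˡ eq , Vec.++-injective _ _ (Vec.∷-injectiveʳ eq)

data JoinNeighbour {n} (b : Bool) (x y : V n) : V (suc (n + n)) → Set where
  first : JoinNeighbour b x y (join (not b) x y)
  left  : ∀ {x′} → x ∼ x′ → JoinNeighbour b x y (join b x′ y)
  right : ∀ {y′} → y ∼ y′ → JoinNeighbour b x y (join b x y′)

join-∼⁻ : ∀ {n b} (x : V n) {y u} → join b x y ∼ u → JoinNeighbour b x y u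
join-∼⁻ x (flip b≢c) rewrite ¬-not (≢-sym b≢c) = first
join-∼⁻ x (keep b xy∼u) with ++-∼⁻ x xy∼u
... | inj₁ (x′ , x∼x′ , refl) = left x∼x′
... | inj₂ (y′ , y∼y′ , refl) = right y∼y′

-- The syndrome for the parity-check matrix whose columns are all nonzero vectors of 𝔽₂ᵏ:
-- the columns for k + 1 are (1 , 0), then (0 , c) and (1 , c) for the columns c for k.
label : ∀ k → V (dim k) → V k
label zero _ = []
label (suc k) (b ∷ v) =
  (b xor parity (Vec.drop (dim k) v)) ∷ label k (Vec.take (dim k) v) ⊕ label k (Vec.drop (dim k) v)

label-join : ∀ k b x y → label (suc k) (join b x y) ≡ (b xor parity y) ∷ label k x ⊕ label k y
label-join k b x y = cong₂ (λ (x y : V (dim k)) → (b xor parity y) ∷ label k x ⊕ label k y) (proj₁ halves) (proj₂ halves)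
  where halves = Vec.++-injective (Vec.take (dim k) (x ++ⱽ y)) x (Vec.take++drop≡id (dim k) (x ++ⱽ y))

-- A flip changes the first bit of the syndrome unless it is in the left half, and the remaining
-- bits unless it is at the first coordinate. This tells the three kinds of neighbours apart.
label-step : ∀ k {b} {x y : V (dim k)} {u} → JoinNeighbour b x y u → V (suc k)
label-step k {b} {x} {y} first = not (b xor parity y) ∷ label k x ⊕ label k y
label-step k {b} {x} {y} (left {x′} _) = (b xor parity y) ∷ label k x′ ⊕ label k y
label-step k {b} {x} {y} (right {y′} _) = not (b xor parity y) ∷ label k x ⊕ label k y′

label-neighbour : ∀ k {b} {x y : V (dim k)} {u} (nb : JoinNeighbour b x y u) → label (suc k) u ≡ label-step k nb
label-neighbour k {b} {x} {y} first =
  trans (label-join k (not b) x y) (cong (_∷ _) (sym (Bool.not-distribˡ-xor b (parity y))))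
label-neighbour k {b} {x} {y} (left {x′} _) = label-join k b x′ y
label-neighbour k {b} {x} {y} (right {y′} y∼y′) = trans (label-join k b x y′)
  (cong (_∷ _) (trans (cong (b xor_) (parity-∼ y∼y′)) (sym (Bool.not-distribʳ-xor b (parity y)))))

-- No column of the parity-check matrix is zero.
label-distinct : ∀ k {v u} → v ∼ u → label k u ≢ label k v
label-distinct zero {[]} ()
label-distinct (suc k) {v} v∼u eq with splitting (dim k) v
... | split b x y = go (join-∼⁻ x v∼u) eq
  where
  go : ∀ {u} → JoinNeighbour b x y u → ¬ label (suc k) u ≡ label (suc k) (join b x y)
  go nb eq with nb | trans (sym (label-neighbour k nb)) (trans eq (label-join k b x y))
  ... | first       | eq′ = not-¬ refl (sym (Vec.∷-injectiveˡ eq′))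
  ... | left x∼x′   | eq′ = label-distinct k x∼x′ (⊕-injectiveˡ (label k y) (Vec.∷-injectiveʳ eq′))
  ... | right y∼y′  | eq′ = not-¬ refl (sym (Vec.∷-injectiveˡ eq′))

-- The columns of the parity-check matrix are pairwise distinct.
label-injective : ∀ k {v u u′} → v ∼ u → v ∼ u′ → label k u ≡ label k u′ → u ≡ u′
label-injective zero {[]} ()
label-injective (suc k) {v} v∼u v∼u′ eq with splitting (dim k) v
... | split b x y = go (join-∼⁻ x v∼u) (join-∼⁻ x v∼u′) eq
  where
  go : ∀ {u u′} → JoinNeighbour b x y u → JoinNeighbour b x y u′ → label (suc k) u ≡ label (suc k) u′ → u ≡ u′
  go nb nb′ eq with nb | nb′ | trans (sym (label-neighbour k nb)) (trans eq (label-neighbour k nb′))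
  ... | first      | first       | _   = refl
  ... | first      | left _      | eq′ = contradiction (sym (Vec.∷-injectiveˡ eq′)) (not-¬ refl)
  ... | first      | right y∼y′  | eq′ =
    contradiction (sym (⊕-injectiveʳ (label k x) (Vec.∷-injectiveʳ eq′))) (label-distinct k y∼y′)
  ... | left _     | first       | eq′ = contradiction (Vec.∷-injectiveˡ eq′) (not-¬ refl)
  ... | left x∼x′  | left x∼x″   | eq′ = cong (λ x → join b x y)
    (label-injective k x∼x′ x∼x″ (⊕-injectiveˡ (label k y) (Vec.∷-injectiveʳ eq′)))
  ... | left _     | right _     | eq′ = contradiction (Vec.∷-injectiveˡ eq′) (not-¬ refl)
  ... | right y∼y′ | first       | eq′ =
    contradiction (⊕-injectiveʳ (label k x) (Vec.∷-injectiveʳ eq′)) (label-distinct k y∼y′)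
  ... | right _    | left _      | eq′ = contradiction (sym (Vec.∷-injectiveˡ eq′)) (not-¬ refl)
  ... | right y∼y′ | right y∼y″  | eq′ = cong (λ y → join b x y)
    (label-injective k y∼y′ y∼y″ (⊕-injectiveʳ (label k x) (Vec.∷-injectiveʳ eq′)))

-- Every nonzero vector is a column. If `t` differs from the present syndrome in the first bit only,
-- the first coordinate is flipped; if in the other bits only, one in the left half; if in both, one
-- in the right half.
label-surjective : ∀ k v t → t ≢ label k v → ∃[ u ] (v ∼ u × label k u ≡ t)
label-surjective zero v [] t≢ = contradiction refl t≢
label-surjective (suc k) v (c ∷ t) ct≢ with splitting (dim k) v
... | split b x y with c Bool.≟ b xor parity y | t ≟ⱽ (label k x ⊕ label k y)
... | yes refl | yes refl = contradiction (sym (label-join k b x y)) ct≢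
... | yes refl | no t≢ =
  let x′ , x∼x′ , eq = label-surjective k x (t ⊕ label k y) (t≢ ∘ sym ∘ ⊕-solveˡ (label k y) ∘ sym)
  in join b x′ y , keep b (++-∼ˡ y x∼x′) ,
     trans (label-neighbour k {b} (left x∼x′)) (cong (_ ∷_) (⊕-solveˡ (label k y) eq))
... | no c≢ | yes refl = join (not b) x y , flip (not-¬ refl) ,
  trans (label-neighbour k {b} first) (cong (_∷ _) (sym (¬-not c≢)))
... | no c≢ | no t≢ =
  let y′ , y∼y′ , eq = label-surjective k y (t ⊕ label k x)
        (λ eq → t≢ (sym (trans (⊕-comm (label k x) (label k y)) (⊕-solveˡ (label k x) (sym eq)))))
  in join b x y′ , keep b (++-∼ʳ x y∼y′) ,
     trans (label-neighbour k {b} (right y∼y′))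
       (cong₂ _∷_ (sym (¬-not c≢)) (trans (⊕-comm (label k x) (label k y′)) (⊕-solveˡ (label k x) eq)))
-- Hamiltonian paths avoiding one label

allⱽ? : ∀ {n} {P : Pred (V n) 0ℓ} → Decidable P → Dec (∀ v → P v)
allⱽ? {zero} P? = map′ (λ { p [] → p }) (λ p → p []) (P? [])
allⱽ? {suc n} P? = map′
  (λ { (p , q) (false ∷ v) → p v ; (p , q) (true ∷ v) → q v })
  (λ p → p ∘ (false ∷_) , p ∘ (true ∷_))
  (allⱽ? (P? ∘ (false ∷_)) ×-dec allⱽ? (P? ∘ (true ∷_)))

orient : ∀ {n} {P : Pred (V n) 0ℓ} b {u v} → parity u ≡ b → parity v ≡ not b → HamPath P u v →
  ∃[ u ] ∃[ v ] (parity u ≡ false × parity v ≡ true × HamPath P u v)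
orient false u-even v-odd h = _ , _ , u-even , v-odd , h
orient true u-odd v-even h = _ , _ , v-even , u-odd , traversal-reverse ∼-sym h

-- The parities of the ends belong to the recursion hypothesis because `hamPath-lace` needs them to
-- link one fibre to the next. All labels `t` are needed, as the label to avoid varies with the
-- fibre.
EvenOddPath : ∀ k → V k → Set
EvenOddPath k t =
  ∃[ u ] ∃[ v ] (parity u ≡ false × parity v ≡ true × HamPath (λ x → label k x ≢ t) u v)

-- The labels of d = (a , b , 0) and of its antipode are (a , b); the other vertices of Q₃ form a hexagon.
hexagon : V 2 → List (V 3)
hexagon (a ∷ b ∷ []) =
  (not a ∷ b ∷ false ∷ []) ∷ (not a ∷ not b ∷ false ∷ []) ∷ (a ∷ not b ∷ false ∷ []) ∷
  (a ∷ not b ∷ true ∷ []) ∷ (a ∷ b ∷ true ∷ []) ∷ (not a ∷ b ∷ true ∷ []) ∷ []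

hexagon-path : ∀ a b → Path _∼_ (not a ∷ b ∷ false ∷ []) (not a ∷ b ∷ true ∷ []) (hexagon (a ∷ b ∷ []))
hexagon-path a b =
  keep _ (flip (not-¬ refl)) ∷ flip (≢-sym (not-¬ refl)) ∷ keep _ (keep _ (flip λ ())) ∷
  keep _ (flip (≢-sym (not-¬ refl))) ∷ flip (not-¬ refl) ∷ [ _ ]

hexagon-enumerates : ∀ t → hexagon t Enumerates (λ x → label 2 x ≢ t)
hexagon-enumerates t = let xs! , xs⇔ = check t in xs! , λ x → mk⇔ (proj₁ (xs⇔ x)) (proj₂ (xs⇔ x))
  where
  -- Exhaustive evaluation over the four labels and the eight vertices.
  check = toWitness {a? = allⱽ? λ t →
    unique? _≟ⱽ_ (hexagon t) ×-dec allⱽ? λ x →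
      (Any.any? (x ≟ⱽ_) (hexagon t) →-dec ¬? (label 2 x ≟ⱽ t)) ×-dec
      (¬? (label 2 x ≟ⱽ t) →-dec Any.any? (x ≟ⱽ_) (hexagon t))} tt

evenOddPath-2 : ∀ t → EvenOddPath 2 t
evenOddPath-2 t@(a ∷ b ∷ []) = orient _ refl (parity-∼ (keep (not a) (keep b (flip {b = false} {true} {[]} λ ()))))
  (hexagon t , hexagon-path a b , hexagon-enumerates t)

last-half : ∀ {n} → V (suc (n + n)) → V n
last-half {n} (b ∷ v) = Vec.drop n v

last-half-join : ∀ {n} b (x y : V n) → last-half (join b x y) ≡ y
last-half-join {n} b x y = proj₂ (Vec.++-injective (Vec.take n (x ++ⱽ y)) x (Vec.take++drop≡id n (x ++ⱽ y)))

module _ (k : ℕ) (path : ∀ t → EvenOddPath k t) (c : Bool) (t : V k) where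

  private
    start finish : V (dim k) → V (dim k)
    start y = proj₁ (path (t ⊕ label k y))
    finish y = proj₁ (proj₂ (path (t ⊕ label k y)))

    -- Of the two copies of Q_(dim k) over y, only the one with first bit `sheet y` meets the label c ∷ t.
    sheet : V (dim k) → Bool
    sheet y = c xor parity y

    Avoids : Pred (V (dim (suc k))) 0ℓ
    Avoids z = label (suc k) z ≢ c ∷ t

    -- The sheet that meets the label is crossed by the recursively given path, ending at the odd
    -- `finish y`; after a flip of the first bit, the full sheet is laced from there to `w`. That
    -- `w` is free lets the next block start above it.
    block : ∀ y w → parity w ≡ false →
      HamPath (λ z → last-half z ≡ y × Avoids z) (join (sheet y) (start y) y) (join (not (sheet y)) w y)
    block y w w-even = let _ , _ , _ , finish-odd , h = path (t ⊕ label k y) in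
      traversal-resp
        (λ z → mk⇔
          (λ { (inj₁ (x , x≢ , refl)) → last-half-join (sheet y) x y , x≢ ∘ avoid x
             ; (inj₂ (x , _ , refl)) → last-half-join (not (sheet y)) x y , full x })
          (meet z))
        (traversal-++ (onto (sheet y) h) (flip (not-¬ refl))
          (onto (not (sheet y)) (hamPath-lace (finish y) w (λ eq → case trans (sym finish-odd) (trans eq w-even) of λ ())))
          λ { _ (_ , _ , refl) (_ , _ , eq) → not-¬ refl (Vec.∷-injectiveˡ eq) })
      where
      onto : ∀ b {P u v} → HamPath P u v → HamPath (λ z → ∃[ x ] (P x × z ≡ join b x y)) (join b u y) (join b v y)
      onto b = traversal-map (proj₁ ∘ proj₂ ∘ join-injective) (keep b ∘ ++-∼ˡ y)
      avoid : ∀ x → label (suc k) (join (sheet y) x y) ≡ c ∷ t → label k x ≡ t ⊕ label k y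
      avoid x eq = trans (sym (⊕-cancelʳ (label k x) (label k y)))
        (cong (_⊕ label k y) (Vec.∷-injectiveʳ (trans (sym (label-join k (sheet y) x y)) eq)))
      full : ∀ x → Avoids (join (not (sheet y)) x y)
      full x eq = not-¬ refl (begin
        c                           ≡⟨ Vec.∷-injectiveˡ (trans (sym eq) (label-join k (not (sheet y)) x y)) ⟩
        not (sheet y) xor parity y  ≡⟨ Bool.not-distribˡ-xor (sheet y) (parity y) ⟨
        not (sheet y xor parity y)  ≡⟨ cong not (xor-cancelʳ c (parity y)) ⟩
        not c                       ∎)
        where open ≡-Reasoning
      meet : ∀ z → last-half z ≡ y × Avoids z →
        (∃[ x ] (label k x ≢ t ⊕ label k y × z ≡ join (sheet y) x y)) ⊎ (∃[ x ] (U x × z ≡ join (not (sheet y)) x y))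
      meet z (eq , z≢) with splitting (dim k) z
      ... | split b x y′ with trans (sym (last-half-join b x y′)) eq | b Bool.≟ sheet y
      ... | refl | no b≢ = inj₂ (x , tt , cong (λ b → join b x y) (¬-not b≢))
      ... | refl | yes refl = inj₁ (x , (λ x≡ → z≢ (trans (label-join k (sheet y) x y)
        (cong₂ _∷_ (xor-cancelʳ c (parity y)) (⊕-solveˡ (label k y) x≡)))) , refl)

    start-even : ∀ y → parity (start y) ≡ false
    start-even y = let _ , _ , even , _ = path (t ⊕ label k y) in even

    -- Adjacent `y` and `y′` have opposite sheets, so the block over `y` can end right beside the
    -- start of the block over `y′`. In the last block the end may be any even vertex.
    chain : ∀ {y y′ ys} → Path _∼_ y y′ ys → Unique ys →
      HamPath (λ z → last-half z ∈ᴸ ys × Avoids z) (join (sheet y) (start y) y) (join (not (sheet y′)) (start y′) y′)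
    chain [ y ] _ = traversal-resp
      (λ z → mk⇔ (λ (eq , z≢) → here eq , z≢) (λ { (here eq , z≢) → eq , z≢ ; (there () , _) }))
      (block y (start y) (start-even y))
    chain (_∷_ {y} {y′} y∼y′ p) (y# ∷ ys!) = traversal-resp
      (λ z → mk⇔ (λ { (inj₁ (eq , z≢)) → here eq , z≢ ; (inj₂ (z∈ , z≢)) → there z∈ , z≢ })
                 (λ { (here eq , z≢) → inj₁ (eq , z≢) ; (there z∈ , z≢) → inj₂ (z∈ , z≢) }))
      (traversal-++ (block y (start y′) (start-even y′)) same-sheet (chain p ys!)
        λ { _ (refl , _) (z∈ , _) → All.lookup y# z∈ refl })
      where
      same-sheet : join (not (sheet y)) (start y′) y ∼ join (sheet y′) (start y′) y′
      same-sheet rewrite parity-∼ y∼y′ | Bool.not-distribʳ-xor c (parity y) = keep _ (++-∼ʳ (start y′) y∼y′)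

    parity-join : ∀ b y → parity (join b (start y) y) ≡ b xor parity y
    parity-join b y = cong (b xor_) (trans (parity-++ (start y) y) (cong (_xor parity y) (start-even y)))

  evenOddPath-suc : EvenOddPath (suc k) (c ∷ t)
  evenOddPath-suc with path t
  -- Only some even and some odd vertex are wanted here, to be joined by a Hamiltonian path of the
  -- base cube.
  ... | y , y′ , y-even , y′-odd , _ with hamPath-lace y y′ (λ eq → case trans (sym y-even) (trans eq y′-odd) of λ ())
  -- The parities of `y` and `y′` cancel against their sheets: the path starts with parity `c` and
  -- finishes with `not c`.
  ... | ys , p , ys! , ys⇔ = orient c
    (trans (parity-join (sheet y) y) (xor-cancelʳ c (parity y)))
    (trans (parity-join (not (sheet y′)) y′)
      (trans (sym (Bool.not-distribˡ-xor (sheet y′) (parity y′))) (cong not (xor-cancelʳ c (parity y′)))))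
    (traversal-resp (λ z → mk⇔ proj₂ (from (ys⇔ (last-half z)) tt ,_)) (chain p ys!))

-- The recursion starts at Q_3: avoiding a label in Q_1 leaves a single vertex, which cannot supply
-- ends of both parities.
evenOddPath : ∀ k t → EvenOddPath (2 + k) t
evenOddPath zero t = evenOddPath-2 t
evenOddPath (suc k) (c ∷ t) = evenOddPath-suc (2 + k) (evenOddPath k) c t
-- Connectivity

-- The predicate is demanded of every vertex but the first, which is why `walk-sym` asks for it
-- there.
Walk : ∀ {n} → Pred (V n) 0ℓ → Rel (V n) 0ℓ
Walk G = Star (λ u v → u ∼ v × G v)

walk-sym : ∀ {n} {G : Pred (V n) 0ℓ} {u v} → G u → Walk G u v → Walk G v u
walk-sym g ε = ε
walk-sym g ((u∼w , g′) ◅ ws) = walk-sym g′ ws ◅◅ (∼-sym u∼w , g) ◅ ε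

walk-keep : ∀ {n} {G : Pred (V n) 0ℓ} {G′ : Pred (V (suc n)) 0ℓ} b →
  (∀ {x} → G x → G′ (b ∷ x)) → ∀ {u v} → Walk G u v → Walk G′ (b ∷ u) (b ∷ v)
walk-keep b G⇒G′ = Star.gmap (b ∷_) (λ (u∼v , g) → keep b u∼v , G⇒G′ g)

layer : ∀ {n} → Bool → List (V (suc n)) → List (V n)
layer b = map Vec.tail ∘ filter ((b Bool.≟_) ∘ Vec.head)

∈-layer⁺ : ∀ {n b} {v : V n} {L} → (b ∷ v) ∈ᴸ L → v ∈ᴸ layer b L
∈-layer⁺ {b = b} v∈ = ∈-map⁺ Vec.tail (∈-filter⁺ ((b Bool.≟_) ∘ Vec.head) v∈ refl)

∈-layer⁻ : ∀ {n b} {v : V n} {L} → v ∈ᴸ layer b L → (b ∷ v) ∈ᴸ L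
∈-layer⁻ {b = b} v∈ with ∈-map⁻ Vec.tail v∈
... | c ∷ _ , cv∈ , refl with ∈-filter⁻ ((b Bool.≟_) ∘ Vec.head) cv∈
... | cv∈L , refl = cv∈L

length-layers : ∀ {n} b (L : List (V (suc n))) → length (layer b L) + length (layer (not b) L) ≡ length L
length-layers b [] = refl
length-layers false ((false ∷ v) ∷ L) = cong suc (length-layers false L)
length-layers false ((true ∷ v) ∷ L) = trans (ℕ.+-suc _ _) (cong suc (length-layers false L))
length-layers true ((false ∷ v) ∷ L) = trans (ℕ.+-suc _ _) (cong suc (length-layers true L))
length-layers true ((true ∷ v) ∷ L) = cong suc (length-layers true L)

Free : ∀ {n} → Pred (V n) 0ℓ → List (V n) → Pred (V n) 0ℓ
Free P L v = ¬ P v × v ∉ᴸ L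

free-layer : ∀ {n} (P : Pred (V (suc n)) 0ℓ) {L b x} → Free (P ∘ (b ∷_)) (layer b L) x → Free P L (b ∷ x)
free-layer P (¬p , x∉) = ¬p , x∉ ∘ ∈-layer⁺

layer-free : ∀ {n} (P : Pred (V (suc n)) 0ℓ) {L b x} → Free P L (b ∷ x) → Free (P ∘ (b ∷_)) (layer b L) x
layer-free P (¬p , bx∉) = ¬p , bx∉ ∘ ∈-layer⁻

-- κ-connectivity of the complement of P, split into connectedness after deletions and more than κ vertices.
Robust Large : ∀ {n} → ℕ → Pred (V n) 0ℓ → Set
Robust κ P = ∀ L → length L < κ → ∀ {u v} → Free P L u → Free P L v → Walk (Free P L) u v
Large κ P = ∀ L → length L ≤ κ → ∃[ x ] Free P L x

connected-via : ∀ {n} {G : Pred (V (suc n)) 0ℓ} b →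
  (∀ {x y} → G (b ∷ x) → G (b ∷ y) → Walk G (b ∷ x) (b ∷ y)) →
  (∀ {x} → G (not b ∷ x) → ∃[ y ] (G (b ∷ y) × Walk G (not b ∷ x) (b ∷ y))) →
  ∀ {u v} → G u → G v → Walk G u v
connected-via {G = G} b within exit {u} {v} gu gv =
  let _ , gx , u→x = reach u gu ; _ , gy , v→y = reach v gv
  in u→x ◅◅ within gx gy ◅◅ walk-sym gv v→y
  where
  reach : ∀ u → G u → ∃[ y ] (G (b ∷ y) × Walk G u (b ∷ y))
  reach (c ∷ x) g with c Bool.≟ b
  ... | yes refl = x , g , ε
  ... | no c≢b rewrite ¬-not c≢b = exit g

-- If neither half loses κ vertices then both are connected and some edge joins them;
-- otherwise one half is intact and every vertex of the other one reaches it.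
robust-suc : ∀ {n κ} {P : Pred (V (suc n)) 0ℓ} → 0 < κ →
  (∀ b → Robust κ (P ∘ (b ∷_))) →
  (∀ L → length L ≤ κ → ∃[ x ] ((∀ b → ¬ P (b ∷ x)) × x ∉ᴸ L)) →
  (∀ b L → length L ≤ κ → ∀ {x} → Free (P ∘ (b ∷_)) L x →
    ∃[ y ] (Free (P ∘ (b ∷_)) L y × ¬ P (not b ∷ y) × Walk (Free (P ∘ (b ∷_)) L) x y)) →
  Robust (suc κ) P
robust-suc {κ = κ} {P} κ>0 robust bridge escape L L<suc-κ = connected (length (layer true L) ℕ.<? κ)
  where
  L≤κ : length L ≤ κ
  L≤κ = s≤s⁻¹ L<suc-κ

  sizes : ∀ b → length (layer b L) + length (layer (not b) L) ≤ κ
  sizes b = ℕ.≤-trans (ℕ.≤-reflexive (length-layers b L)) L≤κ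

  intact : ∀ b → ¬ length (layer b L) < κ → length (layer (not b) L) ≡ 0
  intact b ≮κ = ℕ.n≤0⇒n≡0 (ℕ.+-cancelˡ-≤ (length (layer b L)) _ 0
    (ℕ.≤-trans (sizes b) (ℕ.≤-trans (ℕ.≮⇒≥ ≮κ) (ℕ.m≤m+n _ 0))))

  within : ∀ b → length (layer b L) < κ → ∀ {x y} → Free P L (b ∷ x) → Free P L (b ∷ y) →
    Walk (Free P L) (b ∷ x) (b ∷ y)
  within b <κ fx fy = walk-keep b (free-layer P) (robust b (layer b L) <κ (layer-free P fx) (layer-free P fy))

  exit : ∀ b {x} → Free P L (b ∷ x) → ∃[ y ] (Free P L (not b ∷ y) × Walk (Free P L) (b ∷ x) (not b ∷ y))
  exit b fx with length (layer b L) ℕ.<? κ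
  ... | yes <κ =
    -- Projecting the deletions of both halves to one cube yields a crossing edge with both ends
    -- free.
    let y , ¬p , y∉ = bridge (layer b L ++ layer (not b) L) (ℕ.≤-trans (ℕ.≤-reflexive (length-++ (layer b L))) (sizes b))
        fy = free-layer P (¬p (not b) , y∉ ∘ ∈-++⁺ʳ (layer b L))
    in y , fy , within b <κ fx (free-layer P (¬p b , y∉ ∘ ∈-++⁺ˡ)) ◅◅ (flip (not-¬ refl) , fy) ◅ ε
  ... | no ≮κ =
    -- Nothing is deleted from the other half, so it suffices to walk to some `y` whose twin there
    -- lies outside `P`.
    let y , fy , ¬p , x→y = escape b (layer b L) (ℕ.m+n≤o⇒m≤o _ (sizes b)) (layer-free P fx)
        fy′ = free-layer P (¬p , λ y∈ → contradiction (intact b ≮κ) (ℕ.m<n⇒n≢0 (∈-length y∈)))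
    in y , fy′ , walk-keep b (free-layer P) x→y ◅◅ (flip (not-¬ refl) , fy′) ◅ ε

  connected : Dec (length (layer true L) < κ) → ∀ {u v} → Free P L u → Free P L v → Walk (Free P L) u v
  connected (yes <κ) = connected-via true (within true <κ) (exit false)
  connected (no ≮κ) = connected-via false (within false (subst (_< κ) (sym (intact true ≮κ)) κ>0)) (exit true)

-- Minimum distance at least 3: words at distance 2 would have a common neighbour.
Code : ∀ {n} → Pred (V n) 0ℓ → Set
Code P = (∀ {u v} → u ∼ v → P u → ¬ P v) × (∀ {u v w} → u ∼ v → u ∼ w → P v → P w → v ≡ w)

code-layer : ∀ {n} {P : Pred (V (suc n)) 0ℓ} b → Code P → Code (P ∘ (b ∷_))
code-layer b (apart , unique) =
  apart ∘ keep b , λ u∼v u∼w pv pw → Vec.∷-injectiveʳ (unique (keep b u∼v) (keep b u∼w) pv pw)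

-- Some vertex has all its n + 1 neighbours outside `P`, and `L` cannot cover them: a member of `P`
-- next to `v` is such a vertex by independence, and if there is none, `v` is.
independent-large : ∀ {n} {P : Pred (V (suc n)) 0ℓ} → Decidable P →
  (∀ {u v} → u ∼ v → P u → ¬ P v) → Large n P
independent-large {n} {P} P? apart L L≤n = free-neighbour (Any.any? P? (neighbours v))
  where
  v = Vec.replicate (suc n) false

  neighbour-free : ∀ c → (∀ {x} → c ∼ x → ¬ P x) → ∃[ x ] Free P L x
  neighbour-free c ¬p =
    let xs! , xs⇔ = neighbours-enumerates c
        x , x∈ , x∉ = pigeonhole _≟ⱽ_ xs! L (subst (length L <_) (sym (length-neighbours c)) (s≤s L≤n))
    in x , ¬p (to (xs⇔ x) x∈) , x∉

  free-neighbour : Dec (Any P (neighbours v)) → ∃[ x ] Free P L x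
  free-neighbour (yes p) = let c , _ , pc = find p in neighbour-free c (λ c∼x → apart c∼x pc)
  free-neighbour (no ¬p) =
    neighbour-free v (λ {x} v∼x px → ¬p (lose (from (proj₂ (neighbours-enumerates v) x) v∼x) px))

-- Both halves of a code are codes, so `robust-suc` applies inductively; it needs a positive bound,
-- so Q_2 is treated directly.
code-robust : ∀ n {P : Pred (V (suc n)) 0ℓ} → Decidable P → Code P → Robust n P
code-robust zero P? code L ()
code-robust (suc zero) {P} P? (_ , unique) [] _ {b ∷ c ∷ []} {b′ ∷ c′ ∷ []} _ fv with b Bool.≟ b′ | c Bool.≟ c′
... | yes refl | yes refl = ε
... | yes refl | no c≢ = (keep b (flip c≢) , fv) ◅ ε
... | no b≢ | yes refl = (flip b≢ , fv) ◅ ε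
... | no b≢ | no c≢ with P? (b ∷ c′ ∷ [])
-- Opposite corners of a square: the two corners between them have a common neighbour, so at most
-- one is a word.
...   | no ¬p = (keep b (flip c≢) , ¬p , λ ()) ◅ (flip b≢ , fv) ◅ ε
...   | yes p = (flip b≢ , (λ p′ → b≢ (Vec.∷-injectiveˡ (unique (keep b (flip c≢)) (flip b≢) p p′))) , λ ())
                ◅ (keep b′ (flip c≢) , fv) ◅ ε
code-robust (suc zero) P? code (_ ∷ _) (s≤s ())
code-robust (suc (suc n)) {P} P? code@(apart , unique) = robust-suc (s≤s z≤n)
  (λ b → code-robust (suc n) (P? ∘ (b ∷_)) (code-layer b code)) bridge escape
  where
  -- Two such words would share the neighbour `b ∷ y`.
  crosswise : ∀ {b c x y} → b ≢ c → x ∼ y → P (b ∷ x) → ¬ P (c ∷ y)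
  crosswise {b} b≢c x∼y px py =
    b≢c (Vec.∷-injectiveˡ (unique (∼-sym (keep b x∼y)) (flip b≢c) px py))

  -- The projection of P forgetting the first bit is still independent.
  bridge : ∀ L → length L ≤ suc n → ∃[ x ] ((∀ b → ¬ P (b ∷ x)) × x ∉ᴸ L)
  bridge L L≤ =
    let x , ¬p , x∉ = independent-large {P = λ x → ∃[ b ] P (b ∷ x)} ∃P? ∃P-apart L L≤
    in x , (λ b p → ¬p (b , p)) , x∉
    where
    ∃P? : Decidable (λ x → ∃[ b ] P (b ∷ x))
    ∃P? x with P? (false ∷ x) | P? (true ∷ x)
    ... | yes p | _ = yes (false , p)
    ... | no _ | yes p = yes (true , p)
    ... | no ¬p | no ¬q = no λ { (false , p) → ¬p p ; (true , q) → ¬q q }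

    ∃P-apart : ∀ {u v} → u ∼ v → ∃[ b ] P (b ∷ u) → ¬ (∃[ c ] P (c ∷ v))
    ∃P-apart u∼v (b , p) (c , q) with b Bool.≟ c
    ... | yes refl = apart (keep b u∼v) p q
    ... | no b≢c = crosswise b≢c u∼v p q

  escape : ∀ b L → length L ≤ suc n → ∀ {x} → Free (P ∘ (b ∷_)) L x →
    ∃[ y ] (Free (P ∘ (b ∷_)) L y × ¬ P (not b ∷ y) × Walk (Free (P ∘ (b ∷_)) L) x y)
  escape b L L≤ {x} fx with P? (not b ∷ x)
  ... | no ¬p = x , fx , ¬p , ε
  ... | yes p =
    -- The twin of `x` is a word, so no neighbour of `x` is a word in either half; `x` has n + 2
    -- neighbours, more than `L` can cover.
    let xs! , xs⇔ = neighbours-enumerates x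
        y , y∈ , y∉ = pigeonhole _≟ⱽ_ xs! L (subst (length L <_) (sym (length-neighbours x)) (s≤s L≤))
        x∼y = to (xs⇔ y) y∈
        fy = crosswise (≢-sym (not-¬ refl)) x∼y p , y∉
    in y , fy , apart (keep (not b) x∼y) p , (x∼y , fy) ◅ ε

-- The two layers share at most κ + 1 entries, so one of them has at most κ.
large-tail : ∀ {n κ} {P : Pred (V n) 0ℓ} → Large κ P → Large (suc κ) (P ∘ Vec.tail)
large-tail {κ = κ} {P} large L L≤ with length (layer false L) ℕ.≤? κ
... | yes ≤κ = let x , fx = large (layer false L) ≤κ in false ∷ x , free-layer (P ∘ Vec.tail) fx
... | no ≰κ = let x , fx = large (layer true L) small in true ∷ x , free-layer (P ∘ Vec.tail) fx
  where
  small : length (layer true L) ≤ κ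
  small = ℕ.+-cancelˡ-≤ (suc κ) _ κ (begin
    suc κ + length (layer true L)                     ≤⟨ ℕ.+-monoˡ-≤ _ (ℕ.≰⇒> ≰κ) ⟩
    length (layer false L) + length (layer true L)    ≡⟨ length-layers false L ⟩
    length L                                          ≤⟨ L≤ ⟩
    suc κ                                             ≤⟨ ℕ.m≤m+n (suc κ) κ ⟩
    suc κ + κ                                         ∎)
    where open ℕ.≤-Reasoning

-- The halves are identical copies, so the twin of a vertex outside `P` is outside `P` as well, and
-- escaping takes no step.
robust-tail : ∀ {n κ} {P : Pred (V n) 0ℓ} → 0 < κ → Large κ P → Robust κ P → Robust (suc κ) (P ∘ Vec.tail)
robust-tail κ>0 large robust = robust-suc κ>0 (λ _ → robust)
  (λ L L≤ → let x , ¬p , x∉ = large L L≤ in x , (λ _ → ¬p) , x∉)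
  (λ b L _ fx → _ , fx , proj₁ fx , ε)
-- Sizes

fibres-size : {A B C : Set} {F : B → Pred A 0ℓ} {m : ℕ} (g : B → A → C) →
  (∀ {y y′ x x′} → g y x ≡ g y′ x′ → y ≡ y′ × x ≡ x′) → (∀ y → F y HasSize m) →
  ∀ {ys} → Unique ys → (λ z → ∃[ y ] (y ∈ᴸ ys × ∃[ x ] (F y x × z ≡ g y x))) HasSize (length ys * m)
fibres-size g g-inj fibre [] = [] , [] , (λ z → mk⇔ (λ ()) (λ { (_ , () , _) })) , refl
fibres-size g g-inj fibre {y ∷ ys} (y# ∷ ys!) =
  let xs , xs! , xs⇔ , xs-length = fibre y
      zs , zs! , zs⇔ , zs-length = fibres-size g g-inj fibre ys!
      ws! , ws⇔ = enumerates-resp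
        (λ z → mk⇔ (λ { (inj₁ z∈) → y , here refl , z∈ ; (inj₂ (y′ , y′∈ , z∈)) → y′ , there y′∈ , z∈ })
                   (λ { (_ , here refl , z∈) → inj₁ z∈ ; (y′ , there y′∈ , z∈) → inj₂ (y′ , y′∈ , z∈) }))
        (enumerates-++ (enumerates-map (proj₂ ∘ g-inj) (xs! , xs⇔)) (zs! , zs⇔)
          λ { _ (_ , _ , refl) (_ , y′∈ , _ , _ , eq) → All.lookup y# y′∈ (proj₁ (g-inj eq)) })
  in map (g y) xs ++ zs , ws! , ws⇔ ,
     trans (length-++ (map (g y) xs)) (cong₂ _+_ (trans (length-map (g y) xs) xs-length) zs-length)

size-tail : ∀ {n} {P : Pred (V n) 0ℓ} {e} → P HasSize (2 ^ e) → (P ∘ Vec.tail) HasSize (2 ^ suc e)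
size-tail {e = e} (xs , xs! , xs⇔ , xs-length) =
  let ys! , ys⇔ = double-enumerates (xs! , xs⇔)
  in double xs , ys! , ys⇔ , trans (length-double xs) (trans (ℕ.*-comm (length xs) 2) (cong (2 *_) xs-length))

size-V : ∀ n → U {A = V n} HasSize (2 ^ n)
size-V zero = [] ∷ [] , [] ∷ [] , (λ { [] → mk⇔ (λ _ → tt) (λ _ → here refl) }) , refl
size-V (suc n) = size-tail {e = n} (size-V n)

-- The dimension `dim k` - k of the Hamming code, in the recursive form that `size-label` produces.
codim : ℕ → ℕ
codim zero = 0
codim (suc k) = dim k + codim k

-- For each last half `y` the first bit is forced, and the left half ranges over a coset of the
-- smaller code.
size-label : ∀ k t → (λ x → label k x ≡ t) HasSize (2 ^ codim k)
size-label zero [] = [] ∷ [] , [] ∷ [] , (λ { [] → mk⇔ (λ _ → refl) (λ _ → here refl) }) , refl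
size-label (suc k) (c ∷ t) =
  let ys , ys! , ys⇔ , ys-length = size-V (dim k)
      zs , zs! , zs⇔ , zs-length = fibres-size (λ y x → join (c xor parity y) x y)
        (λ eq → let _ , x≡ , y≡ = join-injective eq in y≡ , x≡) (λ y → size-label k (t ⊕ label k y)) ys!
      ws! , ws⇔ = enumerates-resp (λ z → mk⇔ labelled (λ eq → solve z eq (from (ys⇔ _) tt))) (zs! , zs⇔)
  in zs , ws! , ws⇔ , trans zs-length (trans (cong (_* 2 ^ codim k) ys-length) (sym (ℕ.^-distribˡ-+-* 2 (dim k) (codim k))))
  where
  labelled : ∀ {z} {ys : List (V (dim k))} →
    ∃[ y ] (y ∈ᴸ ys × ∃[ x ] (label k x ≡ t ⊕ label k y × z ≡ join (c xor parity y) x y)) →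
    label (suc k) z ≡ c ∷ t
  labelled (y , _ , x , eq , refl) = trans (label-join k (c xor parity y) x y)
    (cong₂ _∷_ (xor-cancelʳ c (parity y)) (⊕-solveˡ (label k y) eq))
  solve : ∀ z {ys : List (V (dim k))} → label (suc k) z ≡ c ∷ t → last-half z ∈ᴸ ys →
    ∃[ y ] (y ∈ᴸ ys × ∃[ x ] (label k x ≡ t ⊕ label k y × z ≡ join (c xor parity y) x y))
  solve z eq y∈ with splitting (dim k) z
  ... | split b x y with trans (sym (label-join k b x y)) eq
  ... | eq′ = y , subst (_∈ᴸ _) (last-half-join b x y) y∈ , x ,
    trans (sym (⊕-cancelʳ (label k x) (label k y))) (cong (_⊕ label k y) (Vec.∷-injectiveʳ eq′)) ,
    cong (λ b → join b x y) (trans (sym (xor-cancelʳ b (parity y))) (cong (_xor parity y) (Vec.∷-injectiveˡ eq′)))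

dim-codim : ∀ k → k + codim k ≡ dim k
dim-codim zero = refl
dim-codim (suc k) = cong suc (begin
  k + (dim k + codim k)  ≡⟨ ℕ.+-assoc k (dim k) (codim k) ⟨
  k + dim k + codim k    ≡⟨ cong (_+ codim k) (ℕ.+-comm k (dim k)) ⟩
  dim k + k + codim k    ≡⟨ ℕ.+-assoc (dim k) k (codim k) ⟩
  dim k + (k + codim k)  ≡⟨ cong (dim k +_) (dim-codim k) ⟩
  dim k + dim k          ∎)
  where open ≡-Reasoning

suc-dim : ∀ k → suc (dim k) ≡ 2 ^ k
suc-dim zero = refl
suc-dim (suc k) = begin
  suc (suc (dim k + dim k))  ≡⟨ ℕ.+-suc (suc (dim k)) (dim k) ⟨
  suc (dim k) + suc (dim k)  ≡⟨ cong₂ _+_ (suc-dim k) (trans (suc-dim k) (sym (ℕ.+-identityʳ (2 ^ k)))) ⟩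
  2 * 2 ^ k                  ∎
  where open ≡-Reasoning

-- The dominating set

Dominates : ∀ {n} → Pred (V n) 0ℓ → Set
Dominates P = ∀ {v} → ¬ P v → ∃[ u ] (P u × v ∼ u × (∀ {w} → P w → v ∼ w → u ≡ w))

dominates-tail : ∀ {n} {P : Pred (V n) 0ℓ} → Dominates P → Dominates (P ∘ Vec.tail)
dominates-tail dom {b ∷ v} ¬p with dom ¬p
... | u , p , v∼u , unique = b ∷ u , p , keep b v∼u , λ where
  -- The twin of `b ∷ v` has the same tail, so it is no candidate.
  q (flip _) → contradiction q ¬p
  q (keep .b v∼w) → cong (b ∷_) (unique q v∼w)

-- The properties that pass to the product with Q_1. Here `1<n` keeps the connectivity bound
-- positive, as `robust-tail` requires; total domination is obtained from the last factor in
-- `realisable`.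
record Dominator {n} (e : ℕ) (P : Pred (V n) 0ℓ) : Set where
  field
    1<n       : 1 < n
    member?   : Decidable P
    dominates : Dominates P
    size      : P HasSize (2 ^ e)
    large     : Large (n ∸ 1) P
    robust    : Robust (n ∸ 1) P
    {start finish} : V n
    hamPath   : HamPath (¬_ ∘ P) start finish

dominator-tail : ∀ {n e} {P : Pred (V n) 0ℓ} → Dominator e P → Dominator (suc e) (P ∘ Vec.tail)
dominator-tail {suc (suc n)} {e} d = record
  { 1<n = s≤s (s≤s z≤n)
  ; member? = member? ∘ Vec.tail
  ; dominates = dominates-tail dominates
  ; size = size-tail {e = e} size
  ; large = large-tail large
  ; robust = robust-tail (s≤s z≤n) large robust
  ; hamPath = hamPath-tail hamPath
  } where open Dominator d
dominator-tail {suc zero} record { 1<n = s≤s () }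

dominator-label : ∀ k t → Dominator (codim (2 + k)) (λ x → label (2 + k) x ≡ t)
dominator-label k t =
  let _ , _ , _ , _ , h = evenOddPath k t in record
  { 1<n = s≤s (s≤s z≤n)
  ; member? = member?
  ; dominates = λ {v} v≢ → let u , v∼u , eq = label-surjective (2 + k) v t (v≢ ∘ sym) in
      u , eq , v∼u , λ eq′ v∼w → label-injective (2 + k) v∼u v∼w (trans eq (sym eq′))
  ; size = size-label (2 + k) t
  ; large = independent-large member? apart
  ; robust = code-robust _ member?
      (apart , λ u∼v u∼w eq eq′ → label-injective (2 + k) u∼v u∼w (trans eq (sym eq′)))
  ; hamPath = h
  }
  where
  member? = λ x → label (2 + k) x ≟ⱽ t
  apart : ∀ {u v} → u ∼ v → label (2 + k) u ≡ t → label (2 + k) v ≢ t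
  apart u∼v eq eq′ = label-distinct (2 + k) u∼v (trans eq′ (sym eq))

-- Peeling off tails makes each step of `dominator-suffix` a composition with `Vec.tail` by
-- definition.
suffix : ∀ m {n} → V (m + n) → V n
suffix zero v = v
suffix (suc m) v = suffix m (Vec.tail v)

dominator-suffix : ∀ m {n e} {P : Pred (V n) 0ℓ} → Dominator e P → Dominator (m + e) (P ∘ suffix m)
dominator-suffix zero d = d
dominator-suffix (suc m) d = dominator-tail (dominator-suffix m d)

-- Induced subgraphs

T-not⇒¬T : ∀ {b} → T (not b) → ¬ T b
T-not⇒¬T {false} _ ()

¬T⇒T-not : ∀ {b} → ¬ T b → T (not b)
¬T⇒T-not {false} _ = tt
¬T⇒T-not {true} ¬t = ¬t tt

vertex-≡ : ∀ {G : Graph} {S : VertexSet G} {u v : Graph.Vertex (G − S)} → proj₁ u ≡ proj₁ v → u ≡ v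
vertex-≡ {u = u , _} refl = cong (u ,_) (T-irrelevant _ _)

module _ {n : ℕ} (D : VertexSet (Q n)) where

  map-proj₁-toList : ∀ {xs} (xs∉ : All (_∉ D) xs) → map proj₁ (All.toList xs∉) ≡ xs
  map-proj₁-toList [] = refl
  map-proj₁-toList (_ ∷ xs∉) = cong (_ ∷_) (map-proj₁-toList xs∉)

  -- The vertices are paired with proofs of lying outside `D`; these proofs are unique, so a vertex
  -- of the subgraph is determined by its projection and the count is unchanged.
  restrict-size : ∀ {m} {R : Pred (V n) 0ℓ} → (∀ {x} → R x → x ∉ D) → R HasSize m → (R ∘ proj₁ {B = _∉ D}) HasSize m
  restrict-size R⊆ (xs , xs! , xs⇔ , xs-length) = All.toList xs∉ ,
    Unique.map⁻ (subst Unique (sym eq) xs!) ,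
    (λ v → mk⇔
      (λ v∈ → to (xs⇔ _) (subst (proj₁ v ∈ᴸ_) eq (∈-map⁺ proj₁ v∈)))
      (λ r → let _ , w∈ , v≡w = ∈-map⁻ proj₁ (subst (proj₁ v ∈ᴸ_) (sym eq) (from (xs⇔ _) r))
             in subst (_∈ᴸ All.toList xs∉) (sym (vertex-≡ {Q n} {D} v≡w)) w∈)) ,
    trans (sym (length-map proj₁ (All.toList xs∉))) (trans (cong length eq) xs-length)
    where
    xs∉ : All (_∉ D) xs
    xs∉ = All.tabulate (λ x∈ → R⊆ (to (xs⇔ _) x∈))
    eq = map-proj₁-toList xs∉

  hasCycle : ∀ {u v xs} → Path _∼_ u v xs → v ∼ u → Unique xs → All (_∉ D) xs → 3 ≤ length xs →
    HasCycle (Q n − D) (length xs)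
  hasCycle {u} p v∼u xs! xs∉ 3≤ with p | xs∉
  ... | [ _ ]   | _ ∷ _ = contradiction v∼u ∼-irrefl
  ... | u∼w ∷ q | u∉ ∷ ws∉ =
    3≤ , (u , u∉) , All.toList ws∉ ,
    trans (sym (length-map proj₁ (All.toList (u∉ ∷ ws∉)))) (cong length vertices) ,
    Unique.map⁻ (subst Unique (sym vertices) xs!) ,
    Linked.map⁻ (subst (Linked _) (sym (trans (map-++ proj₁ (All.toList (u∉ ∷ ws∉)) _) (cong (_∷ʳ u) vertices)))
      (Linked.map ∼⇒~ (path-linked (u∼w ∷ q) v∼u)))
    where vertices = map-proj₁-toList (u∉ ∷ ws∉)

  connected-minus : ∀ {κ} → Robust κ (_∈ D) → ∀ S s → (_∈ S) HasSize s → s < κ → Connected (Q n − D − S)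
  connected-minus robust S s (xs , xs! , xs⇔ , xs-length) s<κ ((u , u∉D) , u∉S) ((v , v∉D) , v∉S) =
    to-star (robust L L<κ (free u∉D u∉S) (free v∉D v∉S))
    where
    L = map proj₁ xs
    L<κ : length L < _
    L<κ = subst (_< _) (sym (trans (length-map proj₁ xs) xs-length)) s<κ

    free : ∀ {x} (x∉D : x ∉ D) → (x , x∉D) ∉ S → Free (_∈ D) L x
    free {x} x∉D x∉S = T-not⇒¬T x∉D , λ x∈L →
      let w , w∈ , x≡w = ∈-map⁻ proj₁ x∈L
      in T-not⇒¬T x∉S (to (xs⇔ _) (subst (_∈ᴸ xs) (sym (vertex-≡ {Q n} {D} x≡w)) w∈))

    to-star : ∀ {x} {x∉D : x ∉ D} {x∉S : (x , x∉D) ∉ S} → Walk (Free (_∈ D) L) x v →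
      Star (Graph._~_ (Q n − D − S)) ((x , x∉D) , x∉S) ((v , v∉D) , v∉S)
    -- The walk arrives at `v` with possibly different proofs of non-membership, which are equal.
    to-star ε = subst (Star _ _) (vertex-≡ {Q n − D} {S} (vertex-≡ {Q n} {D} refl)) ε
    to-star ((x∼y , ¬y∈D , y∉L) ◅ ws) = ∼⇒~ x∼y ◅ to-star
      {x∉D = ¬T⇒T-not ¬y∈D} {x∉S = ¬T⇒T-not λ y∈S → y∉L (∈-map⁺ proj₁ (from (xs⇔ _) y∈S))} ws

-- The complement in the product with a final edge

Realisable : ℕ → ℕ → Set
Realisable n e = Σ[ D ∈ VertexSet (Q n) ]
  ( TotalPerfectDominating (Q n) D
  × (_∈ D) HasSize (2 ^ e)
  × Regular (Q n − D) (n ∸ 1)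
  × (n ∸ 1) -Connected (Q n − D)
  × Bipancyclic (Q n − D) )

module _ {n e : ℕ} {P : Pred (V n) 0ℓ} (d : Dominator e P) where
  open Dominator d
  private
    module d′ = Dominator (dominator-tail d)

    D : VertexSet (Q (suc n))
    D = isYes ∘ d′.member?

    ∈D⇒P : ∀ {v} → v ∈ D → P (Vec.tail v)
    ∈D⇒P {v} = toWitness {a? = d′.member? v}

    P⇒∈D : ∀ {v} → P (Vec.tail v) → v ∈ D
    P⇒∈D {v} = fromWitness {a? = d′.member? v}

    ∉D⇒¬P : ∀ {v} → v ∉ D → ¬ P (Vec.tail v)
    ∉D⇒¬P {v} = toWitnessFalse {a? = d′.member? v}

    ¬P⇒∉D : ∀ {v} → ¬ P (Vec.tail v) → v ∉ D
    ¬P⇒∉D {v} = fromWitnessFalse {a? = d′.member? v}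

    totalPerfectDominating : TotalPerfectDominating (Q (suc n)) D
    totalPerfectDominating =
      (λ v v∉ → let u , p , v∼u , unique = d′.dominates {v} (∉D⇒¬P {v} v∉) in
        u , (P⇒∈D {u} p , ∼⇒~ {u = v} v∼u) , λ {w} (w∈ , v~w) → unique (∈D⇒P {w} w∈) (~⇒∼ {u = v} v~w)) ,
      -- Membership ignores the first bit, so a member is dominated by its twin.
      λ { (b ∷ x) v∈ → not b ∷ x , P⇒∈D {not b ∷ x} (∈D⇒P {b ∷ x} v∈) , ∼⇒~ (flip (not-¬ refl)) }

    -- Of the n + 1 neighbours in the cube, exactly the dominating one is lost.
    regular : Regular (Q (suc n) − D) n
    regular (v , v∉) =
      let u , p , v∼u , unique = d′.dominates (∉D⇒¬P {v} v∉)
          ys , (ys! , ys⇔) , ys-length = enumerates-remove (neighbours-enumerates v) v∼u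
          ws , ws! , ws⇔ , ws-length = restrict-size D
            (λ {y} (v∼y , y≢u) → ¬P⇒∉D {y} λ q → y≢u (sym (unique q v∼y)))
            (ys , ys! , ys⇔ , ℕ.suc-injective (trans (sym ys-length) (length-neighbours v)))
      in ws , ws! , (λ w → mk⇔ (∼⇒~ ∘ proj₁ ∘ to (ws⇔ w))
           (λ v~w → from (ws⇔ w) (~⇒∼ v~w , λ { refl → ∉D⇒¬P {proj₁ w} (proj₂ w) p }))) , ws-length

    xs : List (V n)
    xs = proj₁ hamPath

    outside-size : U {A = Graph.Vertex (Q (suc n) − D)} HasSize length (double xs)
    outside-size =
      let _ , _ , e = hamPath
          ys! , ys⇔ = double-enumerates e
          ws , ws! , ws⇔ , ws-length = restrict-size D (λ {x} → ¬P⇒∉D {x}) (double xs , ys! , ys⇔ , refl)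
      in ws , ws! , (λ w → mk⇔ (λ _ → tt) (λ _ → from (ws⇔ w) (∉D⇒¬P {proj₁ w} (proj₂ w)))) , ws-length

    -- Were there at most n vertices outside `D`, deleting them all would contradict `d′.large`.
    outside-large : n < length (double xs)
    outside-large = ℕ.≰⇒> λ ≤n →
      let _ , _ , e = hamPath
          x , ¬p , x∉ = d′.large (double xs) ≤n
      in x∉ (from (proj₂ (double-enumerates e) x) ¬p)

    connected : n -Connected (Q (suc n) − D)
    connected = (_ , outside-size , outside-large) , connected-minus D λ L L<n {u} {v} fu fv →
      Star.map (λ { (x∼y , ¬p , y∉) → x∼y , ¬p ∘ ∈D⇒P {_} , y∉ })
        (d′.robust L L<n {u} {v} (proj₁ fu ∘ P⇒∈D {u} , proj₂ fu) (proj₁ fv ∘ P⇒∈D {v} , proj₂ fv))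

    -- A Hamiltonian path of Q n − P and its copy bound a ladder, whose first j rungs span a cycle of length 2j.
    bipancyclic : Bipancyclic (Q (suc n) − D)
    bipancyclic = _ , outside-size , cycle
      where
      cycle : ∀ l → 2 ∣ l → 4 ≤ l → l ≤ length (double xs) → HasCycle (Q (suc n) − D) l
      cycle _ (divides (suc j) refl) 4≤ ≤N =
        let _ , path , xs! , xs⇔ = hamPath
            _ , prefix = path-take path j
            ys! , ys⇔ = double-enumerates (Unique.take⁺ (suc j) xs! , λ x → mk⇔ (λ x∈ → x∈) (λ x∈ → x∈))
            outside = All.take⁺ (suc j) (All.tabulate (λ x∈ → to (xs⇔ _) x∈))
        in subst (HasCycle (Q (suc n) − D)) len
             (hasCycle D (double-path prefix) (flip λ ()) ys!
               (All.tabulate (λ {y} y∈ → ¬P⇒∉D {y} (All.lookup outside (to (ys⇔ y) y∈))))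
               (subst (3 ≤_) (sym len) (ℕ.<⇒≤ 4≤)))
        where
        j<N : suc j ≤ length xs
        j<N = ℕ.*-cancelʳ-≤ (suc j) (length xs) 2 (subst (suc j * 2 ≤_) (length-double xs) ≤N)
        len : length (double (take (suc j) xs)) ≡ suc j * 2
        len = trans (length-double (take (suc j) xs))
          (cong (_* 2) (trans (length-take (suc j) xs) (ℕ.m≤n⇒m⊓n≡m j<N)))

  realisable : Realisable (suc n) (suc e)
  realisable =
    let zs , zs! , zs⇔ , zs-length = d′.size
    in D , totalPerfectDominating ,
       (zs , zs! , (λ v → mk⇔ (P⇒∈D {v} ∘ to (zs⇔ v)) (from (zs⇔ v) ∘ ∈D⇒P {v})) , zs-length) ,
       regular , connected , bipancyclic

theorem6p5 : (n k : ℕ) → 4 ≤ n → 2 ≤ k →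
    2 ^ k ∸ 1 < n → n < 2 ^ (k + 1) ∸ 1 →
    Σ[ D ∈ VertexSet (Q n) ]
    ( TotalPerfectDominating (Q n) D
    × (_∈ D) HasSize (2 ^ (n ∸ k))
    × Regular (Q n − D) (n ∸ 1)
    × (n ∸ 1) -Connected (Q n − D)
    × Bipancyclic (Q n − D) )
theorem6p5 n (suc zero) _ (s≤s ())
theorem6p5 n (suc (suc k)) _ _ 2ᵏ-1<n _ = subst₂ Realisable n≡ e≡
  -- The zero syndrome selects the Hamming code itself.
  (realisable (dominator-suffix m (dominator-label k (Vec.replicate (2 + k) false))))
  where
  r = dim (2 + k)
  e = codim (2 + k)
  -- One of the n - r factors Q_1 is reserved for `realisable`. The subtraction is exact because r =
  -- 2ᵏ - 1 < n, where k is that of the theorem.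
  m = n ∸ suc r

  n≡ : suc (m + r) ≡ n
  n≡ = trans (sym (ℕ.+-suc m r)) (ℕ.m∸n+n≡m (subst (λ p → p ∸ 1 < n) (sym (suc-dim (2 + k))) 2ᵏ-1<n))

  e≡ : suc m + e ≡ n ∸ (2 + k)
  e≡ = begin
    suc m + e                        ≡⟨ ℕ.m+n∸n≡m (suc m + e) (2 + k) ⟨
    suc m + e + (2 + k) ∸ (2 + k)    ≡⟨ cong (_∸ (2 + k)) (ℕ.+-assoc (suc m) e (2 + k)) ⟩
    suc m + (e + (2 + k)) ∸ (2 + k)  ≡⟨ cong (λ r → suc m + r ∸ (2 + k)) (trans (ℕ.+-comm e (2 + k)) (dim-codim (2 + k))) ⟩
    suc m + r ∸ (2 + k)              ≡⟨ cong (_∸ (2 + k)) n≡ ⟩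
    n ∸ (2 + k)                      ∎
    where open ≡-Reasoning
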